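{- Let $\mathcal{K}\subseteq\mathcal{L}$ be a fuzzy language over $E$. If $\mathcal{K}$ is normal with respect to $\mathcal{L}$ and $P$, then $\mathcal{K}$ is observable with respect to $\mathcal{L}$, $P$, and $E_c$ for any $E_c\subseteq E$.
   Context: $E$ is a finite set of events and $E^*$ is the set of all finite strings over $E$, including the empty string $\epsilon$. On $[0,1]$, $\wedge$ denotes infimum (minimum) and $\vee$ supremum. A fuzzy subset of a set $X$ is a function $X\to[0,1]$; $\mathcal{F}(X)$ is the set of all of them; $\mathcal{A}\subseteq\mathcal{B}$ means $\mathcal{A}(x)\le\mathcal{B}(x)$ for all $x$; $\mathrm{supp}(\mathcal{A})=\{x:\mathcal{A}(x)>0\}$; $(\mathcal{A}\cap\mathcal{B})(x)=\mathcal{A}(x)\wedge\mathcal{B}(x)$. A fuzzy language over $E$ is an $\mathcal{A}\in\mathcal{F}(E^*)$ which is either the empty fuzzy language $\mathcal{O}$ (identically $0$), or satisfies $\mathcal{A}(\epsilon)=1$ and $\mathcal{A}(\mu)\ge\mathcal{A}(\mu\nu)$ for all $\mu,\nu\in E^*$. $\mathcal{L}$ is a fixed fuzzy language over $E$ (the behavior of the uncontrolled system). The event set is partitioned as $E=E_o\,\dot\cup\,E_{uo}$ (observable, unobservable). The natural projection $P:E^*\to E_o^*$ erases unobservable events: $P(\epsilon)=\epsilon$, $P(sa)=P(s)P(a)$, where $P(a)=a$ if $a\in E_o$ and $P(a)=\epsilon$ if $a\in E_{uo}$. Define $\mathcal{P}:\mathcal{F}(E^*)\to\mathcal{F}(E_o^*)$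 by $\mathcal{P}(\mathcal{K})(\omega)=\vee_{P(\omega')=\omega}\mathcal{K}(\omega')$ and $\mathcal{P}^{ -1}:\mathcal{F}(E_o^*)\to\mathcal{F}(E^*)$ by $\mathcal{P}^{ -1}(\mathcal{M})(\omega)=\mathcal{M}(P(\omega))$. A fuzzy language $\mathcal{K}\subseteq\mathcal{L}$ is normal with respect to $\mathcal{L}$ and $P$ if $\mathcal{K}=\mathcal{P}^{ -1}[\mathcal{P}(\mathcal{K})]\cap\mathcal{L}$. It is observable with respect to $\mathcal{L}$, $P$, and $E_c$ if for all $s,s'\in\mathrm{supp}(\mathcal{K})$ with $P(s)=P(s')$ and all $a\in E_c$ with $sa\in\mathrm{supp}(\mathcal{K})$, there is some $x\in[0,1]$ with $\mathcal{K}(sa)=\mathcal{K}(s)\wedge\mathcal{L}(sa)\wedge x$ such that $\mathcal{K}(s'a)=\mathcal{K}(s')\wedge\mathcal{L}(s'a)\wedge x$. -}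

module Defs where

open import Data.Fin.Base using (Fin)
open import Data.List.Base using (List; []; [_]; _++_; _∷ʳ_; concatMap)
open import Data.List.Properties using (concatMap-++)
open import Data.Irrelevant as Irrelevant using ()
open import Data.Product.Base using (Σ-syntax; ∃-syntax; _×_; _,_; proj₁; proj₂; swap)
open import Data.Rational.Base as ℚ using (ℚ; 0ℚ; 1ℚ)
open import Data.Rational.Properties as ℚ using (<-dense)
open import Data.Refinement.Base using (Refinement-syntax; _,_)
open import Data.Sum.Base using (_⊎_; inj₁; inj₂; [_,_]′)
open import Function.Base using (id; _∘_)
open import Function.Bundles using (_↔_)
open import Level using (0ℓ)
open import Relation.Binary.Core using (Rel)
open import Relation.Binary.Lattice.Definitions using (Infimum)
open import Relation.Binary.PropositionalEquality using (_≡_; refl)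
open import Relation.Binary.Structures using (IsPartialOrder)
open import Relation.Nullary using (¬_; contradiction)
open import Relation.Unary using (Pred; _∈_; _∉_; _⊆_; _≐_)

-- The real unit interval.  A real is a Dedekind cut given by its lower set: a
-- nonempty proper subset of ℚ that is downward closed and has no greatest
-- element.  It lies in [0,1] iff it contains every q < 0 and only q < 1, which
-- already makes it nonempty and proper.  With lower sets only, suprema of
-- arbitrary families exist without appeal to excluded middle.

record 𝕀 : Set₁ where
  field
    lower      : Pred ℚ 0ℓ
    downward   : ∀ {p q} → p ℚ.< q → q ∈ lower → p ∈ lower
    rounded    : ∀ {p} → p ∈ lower → ∃[ q ] p ℚ.< q × q ∈ lower
    nonneg     : ∀ {q} → q ℚ.< 0ℚ → q ∈ lower
    atMostOne  : ∀ {q} → q ∈ lower → q ℚ.< 1ℚ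

open 𝕀 public using (lower)

infix 4 _≈_ _≤_ _<_

_≈_ : Rel 𝕀 0ℓ
x ≈ y = lower x ≐ lower y

_≤_ : Rel 𝕀 0ℓ
x ≤ y = lower x ⊆ lower y

_<_ : Rel 𝕀 0ℓ
x < y = x ≤ y × ∃[ q ] q ∈ lower y × q ∉ lower x

0𝕀 : 𝕀
0𝕀 = record
  { lower     = ℚ._< 0ℚ
  ; downward  = ℚ.<-trans
  ; rounded   = λ p<0 → let (q , p<q , q<0) = <-dense p<0 in q , p<q , q<0
  ; nonneg    = id
  ; atMostOne = λ q<0 → ℚ.<-trans q<0 (ℚ.positive⁻¹ 1ℚ)
  }

1𝕀 : 𝕀
1𝕀 = record
  { lower     = ℚ._< 1ℚ
  ; downward  = ℚ.<-trans
  ; rounded   = λ p<1 → let (q , p<q , q<1) = <-dense p<1 in q , p<q , q<1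
  ; nonneg    = λ q<0 → ℚ.<-trans q<0 (ℚ.positive⁻¹ 1ℚ)
  ; atMostOne = id
  }

infixr 7 _∧_

_∧_ : 𝕀 → 𝕀 → 𝕀
x ∧ y = record
  { lower     = λ q → q ∈ lower x × q ∈ lower y
  ; downward  = λ p<q (q∈x , q∈y) → X.downward p<q q∈x , Y.downward p<q q∈y
  ; rounded   = λ (p∈x , p∈y) → ∧-rounded (X.rounded p∈x) (Y.rounded p∈y)
  ; nonneg    = λ q<0 → X.nonneg q<0 , Y.nonneg q<0
  ; atMostOne = X.atMostOne ∘ proj₁
  }
  where
  module X = 𝕀 x
  module Y = 𝕀 y

  ≤-closed : ∀ (z : 𝕀) {p q} → p ℚ.≤ q → q ∈ lower z → p ∈ lower z
  ≤-closed z {p} {q} p≤q q∈z =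
    let (r , q<r , r∈z) = 𝕀.rounded z q∈z in
    𝕀.downward z (ℚ.≤-<-trans p≤q q<r) r∈z

  ∧-rounded : ∀ {p} →
              ∃[ q ] p ℚ.< q × q ∈ lower x →
              ∃[ q ] p ℚ.< q × q ∈ lower y →
              ∃[ q ] p ℚ.< q × q ∈ lower x × q ∈ lower y
  ∧-rounded (q , p<q , q∈x) (r , p<r , r∈y) with ℚ.≤-total q r
  ... | inj₁ q≤r = q , p<q , q∈x , ≤-closed y q≤r r∈y
  ... | inj₂ r≤q = r , p<r , ≤-closed x r≤q q∈x , r∈y

-- The disjunct q < 0 only matters for the empty family, whose supremum in
-- [0,1] is 0.

⋁ : {I : Set} → (I → 𝕀) → 𝕀
⋁ {I} f = record
  { lower     = λ q → q ℚ.< 0ℚ ⊎ ∃[ i ] q ∈ lower (f i)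
  ; downward  = λ where
      p<q (inj₁ q<0)       → inj₁ (ℚ.<-trans p<q q<0)
      p<q (inj₂ (i , q∈f)) → inj₂ (i , 𝕀.downward (f i) p<q q∈f)
  ; rounded   = λ where
      (inj₁ p<0)       → let (q , p<q , q<0) = <-dense p<0 in q , p<q , inj₁ q<0
      (inj₂ (i , p∈f)) → let (q , p<q , q∈f) = 𝕀.rounded (f i) p∈f
                         in q , p<q , inj₂ (i , q∈f)
  ; nonneg    = inj₁
  ; atMostOne = λ where
      (inj₁ q<0)       → 𝕀.atMostOne 0𝕀 q<0
      (inj₂ (i , q∈f)) → 𝕀.atMostOne (f i) q∈f
  }

≤-isPartialOrder : IsPartialOrder _≈_ _≤_
≤-isPartialOrder = record
  { isPreorder = record
    { isEquivalence = record
      { refl  = id , id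
      ; sym   = swap
      ; trans = λ (f , g) (h , k) → (λ x → h (f x)) , (λ x → g (k x))
      }
    ; reflexive = λ x≈y → proj₁ x≈y
    ; trans     = λ f g x → g (f x)
    }
  ; antisym = λ x≤y y≤x → x≤y , y≤x
  }

0≤x : ∀ x → 0𝕀 ≤ x
0≤x x = 𝕀.nonneg x

x≤1 : ∀ x → x ≤ 1𝕀
x≤1 x = 𝕀.atMostOne x

∧-infimum : Infimum _≤_ _∧_
∧-infimum x y = proj₁ , proj₂ , λ z z≤x z≤y q∈z → z≤x q∈z , z≤y q∈z

⋁-upper : ∀ {I : Set} (f : I → 𝕀) i → f i ≤ ⋁ f
⋁-upper f i q∈f = inj₂ (i , q∈f)

⋁-least : ∀ {I : Set} (f : I → 𝕀) {y} → (∀ i → f i ≤ y) → ⋁ f ≤ y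
⋁-least f {y} f≤y = [ 𝕀.nonneg y , (λ (i , q∈f) → f≤y i q∈f) ]′

𝓕 : Set → Set₁
𝓕 X = X → 𝕀

module _ {X : Set} where

  infix  4 _≈ᶠ_ _⊆ᶠ_
  infixr 7 _∩_

  _≈ᶠ_ : Rel (𝓕 X) 0ℓ
  A ≈ᶠ B = ∀ x → A x ≈ B x

  _⊆ᶠ_ : Rel (𝓕 X) 0ℓ
  A ⊆ᶠ B = ∀ x → A x ≤ B x

  _∩_ : 𝓕 X → 𝓕 X → 𝓕 X
  (A ∩ B) x = A x ∧ B x

  supp : 𝓕 X → Pred X 0ℓ
  supp A x = 0𝕀 < A x

  𝓞 : 𝓕 X
  𝓞 _ = 0𝕀

IsFuzzyLanguage : {E : Set} → 𝓕 (List E) → Set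
IsFuzzyLanguage A =
  A ≈ᶠ 𝓞 ⊎ (A [] ≈ 1𝕀 × (∀ μ ν → A (μ ++ ν) ≤ A μ))

Finite : Set → Set
Finite E = ∃[ n ] E ↔ Fin n

record ObservabilityPartition (E : Set) : Set₁ where
  field
    Obs      : Pred E 0ℓ
    Unobs    : Pred E 0ℓ
    cover    : ∀ a → a ∈ Obs ⊎ a ∈ Unobs
    disjoint : ∀ {a} → a ∈ Obs → ¬ a ∈ Unobs

  -- Membership proofs are irrelevant here, so distinct elements of Eₒ are
  -- distinct events.
  Eₒ : Set
  Eₒ = [ a ∈ E ∣ Obs a ]

  erase : E → List Eₒ
  erase a with cover a
  ... | inj₁ a∈Obs = [ (a , Irrelevant.[ a∈Obs ]) ]
  ... | inj₂ _     = []

  P : List E → List Eₒ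
  P = concatMap erase

  P-∷ʳ : ∀ s a → P (s ∷ʳ a) ≡ P s ++ P [ a ]
  P-∷ʳ s a = concatMap-++ erase s [ a ]

  P-obs : ∀ {a} (a∈Obs : a ∈ Obs) → P [ a ] ≡ [ (a , Irrelevant.[ a∈Obs ]) ]
  P-obs {a} a∈Obs with cover a
  ... | inj₁ _       = refl
  ... | inj₂ a∈Unobs = contradiction a∈Unobs (disjoint a∈Obs)

  P-unobs : ∀ {a} → a ∈ Unobs → P [ a ] ≡ []
  P-unobs {a} a∈Unobs with cover a
  ... | inj₁ a∈Obs = contradiction a∈Unobs (disjoint a∈Obs)
  ... | inj₂ _     = refl

  𝓟 : 𝓕 (List E) → 𝓕 (List Eₒ)
  𝓟 K ω = ⋁ {Σ[ ω′ ∈ List E ] P ω′ ≡ ω} (λ (ω′ , _) → K ω′)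

  𝓟⁻¹ : 𝓕 (List Eₒ) → 𝓕 (List E)
  𝓟⁻¹ M ω = M (P ω)

module _ {E : Set} (L : 𝓕 (List E)) (π : ObservabilityPartition E) where

  open ObservabilityPartition π

  Normal : 𝓕 (List E) → Set
  Normal K = K ≈ᶠ 𝓟⁻¹ (𝓟 K) ∩ L

  Observable : Pred E 0ℓ → 𝓕 (List E) → Set₁
  Observable E_c K =
    ∀ {s s′} → s ∈ supp K → s′ ∈ supp K → P s ≡ P s′ →
    ∀ {a} → a ∈ E_c → s ∷ʳ a ∈ supp K →
    Σ[ x ∈ 𝕀 ] K (s ∷ʳ a) ≈ K s ∧ L (s ∷ʳ a) ∧ x
             × K (s′ ∷ʳ a) ≈ K s′ ∧ L (s′ ∷ʳ a) ∧ x

{-# OPTIONS --safe #-}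

-- Take x = 𝓟(K)(P(sa)).  Normality reads K(sa) = x ∧ L(sa), and K(sa) ≤ K(s)
-- because K is a fuzzy language, so K(sa) = K(s) ∧ L(sa) ∧ x.  Since P(s) = P(s′)
-- implies P(sa) = P(s′a), the same x serves for s′.

module Submission where

open import Defs
open import Data.List.Base using (List; [_]; _++_; _∷ʳ_)
open import Data.Product.Base using (_,_; proj₁; proj₂)
open import Data.Sum.Base using (inj₁; inj₂)
open import Level using (0ℓ)
open import Relation.Binary.PropositionalEquality
  using (_≡_; refl; sym; cong; module ≡-Reasoning)
open import Relation.Unary using (Pred)

prefix-≥ : {E : Set} (A : 𝓕 (List E)) → IsFuzzyLanguage A →
           ∀ μ ν → A (μ ++ ν) ≤ A μ
-- The empty language has no prefix axiom to invoke; there the left side lies below `0𝕀`, the least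
-- element.
prefix-≥ A (inj₁ A≈𝓞) μ ν q∈A = 0≤x (A μ) (proj₁ (A≈𝓞 (μ ++ ν)) q∈A)
prefix-≥ _ (inj₂ (_ , A-prefix)) = A-prefix

module _ {E : Set} (π : ObservabilityPartition E) where

  open ObservabilityPartition π

  P-∷ʳ-cong : ∀ s s′ → P s ≡ P s′ → ∀ a → P (s ∷ʳ a) ≡ P (s′ ∷ʳ a)
  P-∷ʳ-cong s s′ Ps≡Ps′ a = begin
    P (s ∷ʳ a)       ≡⟨ P-∷ʳ s a ⟩
    P s ++ P [ a ]   ≡⟨ cong (_++ P [ a ]) Ps≡Ps′ ⟩
    P s′ ++ P [ a ]  ≡⟨ P-∷ʳ s′ a ⟨
    P (s′ ∷ʳ a)      ∎
    where open ≡-Reasoning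

  -- Normality makes `K t` the meet of `𝓟 K (P t)` and `L t`, and a further meet with an upper bound
  -- `y` of `K t` changes nothing. Keeping `ω` separate from `P t` lets two strings with equal
  -- projections share the single value `𝓟 K ω`.
  normal-bounded : (L K : 𝓕 (List E)) → Normal L π K →
                   ∀ y {t ω} → K t ≤ y → P t ≡ ω → K t ≈ y ∧ L t ∧ 𝓟 K ω
  normal-bounded _ _ normal _ {t} Kt≤y refl =
    (λ q∈K → let (q∈PK , q∈L) = proj₁ (normal t) q∈K in Kt≤y q∈K , q∈L , q∈PK) ,
    (λ (_ , q∈L , q∈PK) → proj₂ (normal t) (q∈PK , q∈L))

theorem3 : (E : Set) → Finite E →
    (π : ObservabilityPartition E) →
    (L : 𝓕 (List E)) → IsFuzzyLanguage L →
    (K : 𝓕 (List E)) → IsFuzzyLanguage K → K ⊆ᶠ L →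
    Normal L π K →
    (E_c : Pred E 0ℓ) → Observable L π E_c K
theorem3 E _ π L _ K K-lang _ normal E_c {s} {s′} _ _ Ps≡Ps′ {a} _ _ =
  𝓟 K (P (s ∷ʳ a)) ,
  normal-bounded π L K normal (K s) (prefix-≥ K K-lang s [ a ]) refl ,
  normal-bounded π L K normal (K s′) (prefix-≥ K K-lang s′ [ a ])
    -- The witness is fixed at the projection of `s ∷ʳ a`, so that of `s′ ∷ʳ a` has to be carried to
    -- it; hence the `sym`.
    (P-∷ʳ-cong π s′ s (sym Ps≡Ps′) a)
  where open ObservabilityPartition π
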